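{- For every integer $k\ge1$, $$G^{k(k-1)\cdots1}_{2\text{ - }31}(x)=\begin{cases}x^kC^{k+1}(x),&\text{if }k\ge2,\\ C(x),&\text{if }k=1,\end{cases}$$ where $C^{k+1}(x)=(C(x))^{k+1}$.
   Context: A permutation $\pi=\pi_1\cdots\pi_n$ of $\{1,\dots,n\}$ contains the generalized pattern $2\text{ - }31$ if there are indices $i<j<n$ such that $\pi_i\pi_j\pi_{j+1}$ is order-isomorphic to $231$; otherwise it avoids it. A permutation $\pi$ begins with a pattern $p=p_1\cdots p_k$ if $n\ge k$ and $\pi_1\cdots\pi_k$ is order-isomorphic to $p$; by convention, the empty permutation is also regarded as beginning with the pattern $1$ (the case $k=1$). $G^p_q(x)=\sum_{n\ge0}N^p_q(n)x^n$, where $N^p_q(n)$ is the number of permutations of $\{1,\dots,n\}$ that avoid $q$ and begin with $p$. $C(x)=\sum_{n\ge0}C_nx^n=\frac{1-\sqrt{1-4x}}{2x}$ is the generating function of the Catalan numbers $C_n=\frac1{n+1}\binom{2n}{n}$. -}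

module Defs where

open import Data.Nat.Base using (ℕ; zero; suc; _+_; _*_; _∸_; _/_; _≤_)
open import Data.Nat.Properties using (_≤?_; ≤-irrelevant)
import Data.Nat.Properties as ℕ
open import Data.Nat.Combinatorics using (_C_)
open import Data.Nat.ListAction using (sum)
open import Data.Fin.Base as Fin using (Fin; toℕ; opposite)
open import Data.Fin.Patterns using (0F; 1F; 2F)
import Data.Fin.Properties as Fin
open import Data.List.Base using (List; []; _∷_; length; filter; applyUpTo; allFin; cartesianProductWith)
open import Data.List.Membership.Propositional using (_∈_)
open import Data.List.Membership.Propositional.Properties using (∈-allFin; ∈-cartesianProductWith⁺)
open import Data.List.Relation.Unary.Any using (here)
open import Data.List.Relation.Unary.All using ([])
open import Data.List.Relation.Unary.AllPairs using ([]; _∷_)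
import Data.List.Relation.Unary.Unique.Propositional as List
import Data.List.Relation.Unary.Unique.Propositional.Properties as List
open import Data.Product.Base using (Σ; _×_; _,_)
open import Data.Sum.Base using (_⊎_)
open import Data.Vec.Base using (Vec; []; _∷_; lookup; tabulate; truncate)
open import Data.Vec.Properties using (∷-injective)
open import Data.Vec.Relation.Unary.AllPairs using (allPairs?)
open import Data.Vec.Relation.Unary.Unique.Propositional using (Unique)
open import Function.Bundles using (_⇔_; mk⇔; Equivalence)
open import Relation.Binary.PropositionalEquality using (_≡_; refl; subst)
open import Relation.Nullary using (Dec; yes; no; ¬_)
open import Relation.Nullary.Decidable using (map′; ¬?; _×-dec_; _⊎-dec_; _→-dec_)
open import Relation.Unary using (Decidable)

-- A permutation π₁⋯πₙ of {1,…,n} is the word π : Vec (Fin n) n with distinct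
-- entries, a : Fin n standing for the value toℕ a + 1; likewise for positions
-- and for patterns.

OrderIsomorphic : ∀ {m n k} → Vec (Fin m) k → Vec (Fin n) k → Set
OrderIsomorphic u v = ∀ i j → (lookup u i Fin.< lookup u j) ⇔ (lookup v i Fin.< lookup v j)

231-pattern : Vec (Fin 3) 3
231-pattern = 1F ∷ 2F ∷ 0F ∷ []

Contains2-31 : ∀ {n} → Vec (Fin n) n → Set
Contains2-31 {n} π = Σ (Fin n) λ i → Σ (Fin n) λ j → Σ (Fin n) λ j⁺ →
  i Fin.< j × toℕ j⁺ ≡ suc (toℕ j) ×
  OrderIsomorphic (lookup π i ∷ lookup π j ∷ lookup π j⁺ ∷ []) 231-pattern

Avoids2-31 : ∀ {n} → Vec (Fin n) n → Set
Avoids2-31 π = ¬ Contains2-31 π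

-- The second summand is the convention that the empty permutation begins with
-- the pattern 1, the only pattern of length 1.
BeginsWith : ∀ {k n} → Vec (Fin k) k → Vec (Fin n) n → Set
BeginsWith {k} {n} p π =
  (Σ (k ≤ n) λ k≤n → OrderIsomorphic (truncate k≤n π) p) ⊎ (n ≡ 0 × k ≡ 1)

descending : ∀ k → Vec (Fin k) k
descending k = tabulate opposite

Counted : ∀ {k n} → Vec (Fin k) k → Vec (Fin n) n → Set
Counted p π = Unique π × Avoids2-31 π × BeginsWith p π

_⇔-dec_ : {A B : Set} → Dec A → Dec B → Dec (A ⇔ B)
a? ⇔-dec b? = map′ (λ (f , g) → mk⇔ f g) (λ e → Equivalence.to e , Equivalence.from e)
  ((a? →-dec b?) ×-dec (b? →-dec a?))

orderIsomorphic? : ∀ {m n k} (u : Vec (Fin m) k) (v : Vec (Fin n) k) → Dec (OrderIsomorphic u v)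
orderIsomorphic? u v = Fin.all? λ i → Fin.all? λ j →
  (lookup u i Fin.<? lookup u j) ⇔-dec (lookup v i Fin.<? lookup v j)

contains2-31? : ∀ {n} → Decidable (Contains2-31 {n})
contains2-31? π = Fin.any? λ i → Fin.any? λ j → Fin.any? λ j⁺ →
  (i Fin.<? j) ×-dec (toℕ j⁺ ℕ.≟ suc (toℕ j)) ×-dec
  orderIsomorphic? (lookup π i ∷ lookup π j ∷ lookup π j⁺ ∷ []) 231-pattern

beginsWith? : ∀ {k n} (p : Vec (Fin k) k) → Decidable (BeginsWith {k} {n} p)
beginsWith? {k} {n} p π = prefix? ⊎-dec ((n ℕ.≟ 0) ×-dec (k ℕ.≟ 1))
  where
  prefix? : Dec (Σ (k ≤ n) λ k≤n → OrderIsomorphic (truncate k≤n π) p)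
  prefix? with k ≤? n
  ... | no k≰n  = no λ (k≤n , _) → k≰n k≤n
  ... | yes k≤n = map′ (k≤n ,_)
    (λ (k≤n′ , iso) → subst (λ le → OrderIsomorphic (truncate le π) p) (≤-irrelevant k≤n′ k≤n) iso)
    (orderIsomorphic? (truncate k≤n π) p)

counted? : ∀ {k n} (p : Vec (Fin k) k) → Decidable (Counted {k} {n} p)
counted? p π =
  allPairs? (λ a b → ¬? (a Fin.≟ b)) π ×-dec ¬? (contains2-31? π) ×-dec beginsWith? p π

words : ∀ n m → List (Vec (Fin n) m)
words n zero    = [] ∷ []
words n (suc m) = cartesianProductWith _∷_ (allFin n) (words n m)

∈-words : ∀ {n m} (w : Vec (Fin n) m) → w ∈ words n m
∈-words []      = here refl
∈-words (a ∷ w) = ∈-cartesianProductWith⁺ _∷_ (∈-allFin a) (∈-words w)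

words-unique : ∀ n m → List.Unique (words n m)
words-unique n zero    = [] ∷ []
words-unique n (suc m) =
  List.cartesianProductWith⁺ _∷_ ∷-injective (List.allFin⁺ n) (words-unique n m)

N²⁻³¹ : ∀ {k} → Vec (Fin k) k → ℕ → ℕ
N²⁻³¹ p n = length (filter (counted? p) (words n n))

-- A formal power series is its sequence of coefficients; equality of series is _≗_.
PowerSeries : Set
PowerSeries = ℕ → ℕ

infixl 7 _·_
infixr 8 _^_

_·_ : PowerSeries → PowerSeries → PowerSeries
(f · g) n = sum (applyUpTo (λ i → f i * g (n ∸ i)) (suc n))

𝟙 : PowerSeries
𝟙 zero    = 1
𝟙 (suc _) = 0

_^_ : PowerSeries → ℕ → PowerSeries
f ^ zero  = 𝟙
f ^ suc k = f · f ^ k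

X : PowerSeries
X 1 = 1
X _ = 0

G²⁻³¹ : ∀ {k} → Vec (Fin k) k → PowerSeries
G²⁻³¹ p = N²⁻³¹ p

-- Cₙ = binom(2n,n)/(n+1); the division is exact.
catalan : ℕ → ℕ
catalan n = ((2 * n) C n) / suc n

C[x] : PowerSeries
C[x] n = catalan n

{-# OPTIONS --safe #-}

-- Let D(k,n) count the 2-31-avoiders of length n whose first k letters descend.
-- If, in an avoider of length n+1 whose first k+1 letters descend, letter k+1 is
-- not followed by a smaller one, then everything after it is larger, so it is the
-- minimum; deleting it gives D(k+1,n+1) = D(k,n) + D(k+2,n+1). The coefficients of
-- C(x)ᵏ satisfy the same recurrence, since Cᵏ⁺¹ = Cᵏ + x Cᵏ⁺², whence
-- D(k,m+k) = [xᵐ] C(x)ᵏ⁺¹. The binomial formula for Cₙ is the reflection identity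
-- [xⁿ] C(x)ᵏ⁺¹ = binom(2n+k,n) − binom(2n+k,n−1) at k = 0.
module Submission where

open import Data.Fin.Base as Fin using (Fin; zero; suc; toℕ; opposite)
open import Data.Fin.Patterns using (0F; 1F; 2F)
import Data.Fin.Properties as Fin
open import Data.List.Base as List using (List; []; _∷_; length; filter; applyUpTo)
open import Data.List.Membership.Propositional as List using ()
open import Data.List.Membership.Propositional.Properties
  using (∈-filter⁺; ∈-filter⁻; ∈-map⁺; ∈-map⁻; ∈-++⁺ˡ; ∈-++⁺ʳ; ∈-++⁻)
open import Data.List.Membership.Propositional.Properties.WithK using (unique∧set⇒bag)
open import Data.List.Properties using (length-map; length-++)
open import Data.List.Relation.Binary.BagAndSetEquality using (∼bag⇒↭)
open import Data.List.Relation.Binary.Permutation.Propositional.Properties using (↭-length)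
import Data.List.Relation.Unary.All as List using ([])
import Data.List.Relation.Unary.AllPairs as List using ([]; _∷_)
open import Data.List.Relation.Unary.Any using (here)
import Data.List.Relation.Unary.Unique.Propositional as List using (Unique)
import Data.List.Relation.Unary.Unique.Propositional.Properties as List
open import Data.Nat.Base as ℕ using (ℕ; zero; suc; _+_; _*_; _∸_; _/_; _≤_; z≤n; s≤s)
open import Data.Nat.Combinatorics using (_C_; nCk≡nC[n∸k]; nCk+nC[k+1]≡[n+1]C[k+1])
open import Data.Nat.DivMod using (m*n/n≡m)
open import Data.Nat.ListAction using (sum)
open import Data.Nat.Properties as ℕ
  using (+-assoc; +-cancelʳ-≡; +-comm; +-identityʳ; +-suc; *-comm; *-distribʳ-+; *-distribˡ-+;
         *-zeroʳ; m+n∸n≡m; m≤m+n; n≤1+n; ≤-trans)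
open import Data.Nat.Tactic.RingSolver using (solve-∀)
open import Data.Product.Base using (Σ; ∃; ∃₂; _×_; _,_; proj₁; proj₂)
open import Data.Sum.Base as Sum using (_⊎_; inj₁; inj₂)
open import Data.Vec.Base as Vec using (Vec; []; _∷_; lookup; truncate)
open import Data.Vec.Membership.Propositional using (_∈_)
open import Data.Vec.Properties using (∷-injective; lookup∘tabulate)
open import Data.Vec.Relation.Unary.All as All using (All; []; _∷_)
import Data.Vec.Relation.Unary.All.Properties as All
open import Data.Vec.Relation.Unary.AllPairs using ([]; _∷_)
open import Data.Vec.Relation.Unary.Any using (here; there)
open import Data.Vec.Relation.Unary.Unique.Propositional using (Unique)
import Data.Vec.Relation.Unary.Unique.Propositional.Properties as Unique
open import Function.Base using (_∘_; const)
open import Function.Bundles using (_⇔_; mk⇔; Equivalence)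
open import Relation.Binary.Definitions using (tri<; tri≈; tri>)
open import Relation.Binary.PropositionalEquality
  using (_≡_; _≢_; _≗_; refl; sym; trans; cong; cong₂; subst; subst₂; module ≡-Reasoning)
open import Relation.Nullary using (Dec; yes; no; ¬_)
open import Relation.Nullary.Negation using (contradiction)
open import Defs

-- Power series and ballot numbers

sum-cong : ∀ {f g : ℕ → ℕ} → f ≗ g → ∀ n → sum (applyUpTo f n) ≡ sum (applyUpTo g n)
sum-cong f≗g zero    = refl
sum-cong f≗g (suc n) = cong₂ _+_ (f≗g 0) (sum-cong (λ i → f≗g (suc i)) n)

sum-zero : ∀ n → sum (applyUpTo (λ _ → 0) n) ≡ 0
sum-zero zero    = refl
sum-zero (suc n) = sum-zero n

sum-+ : ∀ (f g : ℕ → ℕ) n →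
  sum (applyUpTo (λ i → f i + g i) n) ≡ sum (applyUpTo f n) + sum (applyUpTo g n)
sum-+ f g zero    = refl
sum-+ f g (suc n)
  rewrite sum-+ (λ i → f (suc i)) (λ i → g (suc i)) n =
  interchange (f 0) (g 0) (sum (applyUpTo (λ i → f (suc i)) n)) (sum (applyUpTo (λ i → g (suc i)) n))
  where
  interchange : ∀ a b c d → (a + b) + (c + d) ≡ (a + c) + (b + d)
  interchange = solve-∀

·-cong : ∀ {f f′ g g′} → f ≗ f′ → g ≗ g′ → f · g ≗ f′ · g′
·-cong f≗f′ g≗g′ n = sum-cong (λ i → cong₂ _*_ (f≗f′ i) (g≗g′ (n ∸ i))) (suc n)

·-distribʳ-+ : ∀ f g h n → ((λ i → f i + g i) · h) n ≡ (f · h) n + (g · h) n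
·-distribʳ-+ f g h n = trans
  (sum-cong (λ i → *-distribʳ-+ (h (n ∸ i)) (f i) (g i)) (suc n))
  (sum-+ (λ i → f i * h (n ∸ i)) (λ i → g i * h (n ∸ i)) (suc n))

·-identityˡ : ∀ f → 𝟙 · f ≗ f
·-identityˡ f n = trans (cong₂ _+_ (+-identityʳ (f n)) (sum-zero n)) (+-identityʳ (f n))

-- Multiplication by x in a form that computes: the leading term of a convolution with a shifted
-- series is 0 and reduces away, so `shift-·` holds by `refl`.
shift : PowerSeries → PowerSeries
shift f zero    = 0
shift f (suc n) = f n

shift-cong : ∀ {f g} → f ≗ g → shift f ≗ shift g
shift-cong f≗g zero    = refl
shift-cong f≗g (suc n) = f≗g n

shift-· : ∀ f g → shift f · g ≗ shift (f · g)
shift-· f g zero    = refl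
shift-· f g (suc n) = refl

X≗shift𝟙 : X ≗ shift 𝟙
X≗shift𝟙 0             = refl
X≗shift𝟙 1             = refl
X≗shift𝟙 (suc (suc n)) = refl

X·≗shift : ∀ f → X · f ≗ shift f
X·≗shift f n = trans (·-cong {g = f} X≗shift𝟙 (λ _ → refl) n)
  (trans (shift-· 𝟙 f n) (shift-cong (·-identityˡ f) n))

X^suc-· : ∀ k f → X ^ suc k · f ≗ shift (X ^ k · f)
X^suc-· k f n = trans (·-cong {g = f} (X·≗shift (X ^ k)) (λ _ → refl) n) (shift-· (X ^ k) f n)

X^-·-< : ∀ k f {n} → n ℕ.< k → (X ^ k · f) n ≡ 0
X^-·-< (suc k) f {zero}  _         = X^suc-· k f 0
X^-·-< (suc k) f {suc n} (s≤s n<k) = trans (X^suc-· k f (suc n)) (X^-·-< k f n<k)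

X^-·-+ : ∀ k f n → (X ^ k · f) (n + k) ≡ f n
X^-·-+ zero    f n = trans (·-identityˡ f (n + 0)) (cong f (+-identityʳ n))
X^-·-+ (suc k) f n = trans (cong (X ^ suc k · f) (+-suc n k))
  (trans (X^suc-· k f (suc (n + k))) (X^-·-+ k f n))

-- The coefficients of C(x)ᵏ, by the recurrence C(x)ᵏ⁺¹ = C(x)ᵏ + x C(x)ᵏ⁺².
ballot : ℕ → PowerSeries
ballot k       zero    = 1
ballot zero    (suc n) = 0
ballot (suc k) (suc n) = ballot k (suc n) + ballot (suc (suc k)) n

ballot-suc : ∀ k n → ballot (suc k) n ≡ ballot k n + shift (ballot (suc (suc k))) n
ballot-suc k zero    = refl
ballot-suc k (suc n) = refl

ballot-zero : ballot 0 ≗ 𝟙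
ballot-zero zero    = refl
ballot-zero (suc n) = refl

ballot-·-suc : ∀ j k n → (ballot (suc j) · ballot k) n ≡
  (ballot j · ballot k) n + shift (ballot (suc (suc j)) · ballot k) n
ballot-·-suc j k n = begin
  (ballot (suc j) · ballot k) n
    ≡⟨ ·-cong {g = ballot k} (ballot-suc j) (λ _ → refl) n ⟩
  ((λ i → ballot j i + shift (ballot (suc (suc j))) i) · ballot k) n
    ≡⟨ ·-distribʳ-+ (ballot j) (shift (ballot (suc (suc j)))) (ballot k) n ⟩
  (ballot j · ballot k) n + (shift (ballot (suc (suc j))) · ballot k) n
    ≡⟨ cong ((ballot j · ballot k) n +_) (shift-· (ballot (suc (suc j))) (ballot k) n) ⟩
  (ballot j · ballot k) n + shift (ballot (suc (suc j)) · ballot k) n ∎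
  where open ≡-Reasoning

-- For fixed k both sides obey the same recurrence in j and n. It passes from j + 1 to j at the same
-- n, or to j + 2 at n - 1, so the induction is lexicographic in n, then j. This makes `ballot k`
-- the k-th power of `ballot 1`.
ballot-· : ∀ j k → ballot j · ballot k ≗ ballot (j + k)
ballot-· zero    k n       = trans (·-cong {g = ballot k} ballot-zero (λ _ → refl) n) (·-identityˡ (ballot k) n)
ballot-· (suc j) k zero    = refl
ballot-· (suc j) k (suc n) = trans (ballot-·-suc j k (suc n))
  (cong₂ _+_ (ballot-· j k (suc n)) (ballot-· (suc (suc j)) k n))

-- Binomial formula for the ballot numbers

-- binom(n,k−1) without truncated subtraction, so that Pascal's rule holds at k = 0.
lowerC : ℕ → ℕ → ℕ
lowerC n zero    = 0
lowerC n (suc k) = n C k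

pascal : ∀ n k → suc n C k ≡ lowerC n k + n C k
pascal n zero    = refl
pascal n (suc k) = sym (nCk+nC[k+1]≡[n+1]C[k+1] n k)

-- The identity (k+1) binom(n,k+1) = (n-k) binom(n,k) with the subtraction moved to the other side;
-- it follows from Pascal's rule by induction on n.
absorption : ∀ n k → suc k * (n C suc k) + k * (n C k) ≡ n * (n C k)
absorption zero    zero    = refl
absorption zero    (suc k) = cong₂ _+_ (*-zeroʳ k) (*-zeroʳ k)
absorption (suc n) k = begin
  suc k * (suc n C suc k) + k * (suc n C k)
    ≡⟨ cong₂ (λ a b → suc k * a + k * b) (pascal n (suc k)) (pascal n k) ⟩
  suc k * (n C k + n C suc k) + k * (lowerC n k + n C k)
    ≡⟨ regroup k (lowerC n k) (n C k) (n C suc k) ⟩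
  (suc k * (n C suc k) + k * (n C k)) + (k * lowerC n k + k * (n C k)) + n C k
    ≡⟨ cong₂ (λ a b → a + b + n C k) (absorption n k) (lower k) ⟩
  n * (n C k) + (n * lowerC n k + lowerC n k) + n C k
    ≡⟨ collect n (lowerC n k) (n C k) ⟩
  suc n * (lowerC n k + n C k)
    ≡⟨ cong (suc n *_) (pascal n k) ⟨
  suc n * (suc n C k) ∎
  where
  open ≡-Reasoning
  regroup : ∀ k a b c → suc k * (b + c) + k * (a + b) ≡ (suc k * c + k * b) + (k * a + k * b) + b
  regroup = solve-∀
  collect : ∀ n a b → n * b + (n * a + a) + b ≡ suc n * (a + b)
  collect = solve-∀
  -- The induction hypothesis one index lower; through `lowerC` it also covers k = 0, where both
  -- sides vanish.
  lower : ∀ k → k * lowerC n k + k * (n C k) ≡ n * lowerC n k + lowerC n k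
  lower zero    = sym (trans (+-identityʳ _) (*-zeroʳ n))
  lower (suc k) = begin
    suc k * (n C k) + suc k * (n C suc k)   ≡⟨ swap k (n C k) (n C suc k) ⟩
    (suc k * (n C suc k) + k * (n C k)) + n C k ≡⟨ cong (_+ n C k) (absorption n k) ⟩
    n * (n C k) + n C k ∎
    where
    swap : ∀ k a b → suc k * a + suc k * b ≡ (suc k * b + k * a) + a
    swap = solve-∀

double-suc : ∀ n → suc n + suc n ≡ suc (suc (n + n))
double-suc n = cong suc (+-suc n n)

-- By Pascal's rule the difference of the two binomials obeys the recurrence of `ballot`. At k = 0
-- the summand `ballot 0 (suc n)` is 0, and the symmetry of row 2n+1 about its centre replaces the
-- missing hypothesis.
ballot-binomial : ∀ k n → ballot (suc k) n + lowerC (n + n + k) n ≡ (n + n + k) C n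
ballot-binomial k zero = refl
ballot-binomial zero (suc n) = begin
  ballot 2 n + (suc n + suc n + 0) C n
    ≡⟨ cong (λ m → ballot 2 n + m C n) top ⟩
  ballot 2 n + suc N C n
    ≡⟨ cong (ballot 2 n +_) (pascal N n) ⟩
  ballot 2 n + (lowerC N n + N C n)
    ≡⟨ +-assoc (ballot 2 n) (lowerC N n) (N C n) ⟨
  ballot 2 n + lowerC N n + N C n
    ≡⟨ cong (_+ N C n) ih ⟩
  N C n + N C n
    ≡⟨ cong (N C n +_) symmetric ⟩
  N C n + N C suc n
    ≡⟨ pascal N (suc n) ⟨
  suc N C suc n
    ≡⟨ cong (_C suc n) top ⟨
  (suc n + suc n + 0) C suc n ∎
  where
  open ≡-Reasoning
  N = suc (n + n)
  top : suc n + suc n + 0 ≡ suc N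
  top = trans (+-identityʳ _) (double-suc n)
  ih : ballot 2 n + lowerC N n ≡ N C n
  ih = subst (λ m → ballot 2 n + lowerC m n ≡ m C n) (+-comm (n + n) 1) (ballot-binomial 1 n)
  symmetric : N C n ≡ N C suc n
  symmetric = trans (nCk≡nC[n∸k] (≤-trans (m≤m+n n n) (n≤1+n _)))
    (cong (N C_) (m+n∸n≡m (suc n) n))
ballot-binomial (suc k) (suc n) = begin
  ballot (suc k) (suc n) + ballot (3 + k) n + (suc n + suc n + suc k) C n
    ≡⟨ cong (λ m → ballot (suc k) (suc n) + ballot (3 + k) n + m C n) (+-suc (suc n + suc n) k) ⟩
  ballot (suc k) (suc n) + ballot (3 + k) n + suc N C n
    ≡⟨ cong (ballot (suc k) (suc n) + ballot (3 + k) n +_) (pascal N n) ⟩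
  ballot (suc k) (suc n) + ballot (3 + k) n + (lowerC N n + N C n)
    ≡⟨ regroup (ballot (suc k) (suc n)) (ballot (3 + k) n) (lowerC N n) (N C n) ⟩
  (ballot (3 + k) n + lowerC N n) + (ballot (suc k) (suc n) + N C n)
    ≡⟨ cong₂ _+_ ih (ballot-binomial k (suc n)) ⟩
  N C n + N C suc n
    ≡⟨ pascal N (suc n) ⟨
  suc N C suc n
    ≡⟨ cong (_C suc n) (+-suc (suc n + suc n) k) ⟨
  (suc n + suc n + suc k) C suc n ∎
  where
  open ≡-Reasoning
  N = suc n + suc n + k
  regroup : ∀ a b c d → a + b + (c + d) ≡ (b + c) + (a + d)
  regroup = solve-∀
  top : ∀ n k → n + n + suc (suc k) ≡ suc n + suc n + k
  top = solve-∀
  ih : ballot (3 + k) n + lowerC N n ≡ N C n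
  ih = subst (λ m → ballot (3 + k) n + lowerC m n ≡ m C n) (top n k) (ballot-binomial (2 + k) n)

-- Absorption in row 2n at index n - 1, where the factor is 2n - (n-1) = n + 1. It turns the
-- reflection difference into a quotient by n + 1.
[1+n]*lowerC[2n,n] : ∀ n → suc n * lowerC (2 * n) n ≡ n * ((2 * n) C n)
[1+n]*lowerC[2n,n] zero    = refl
[1+n]*lowerC[2n,n] (suc n) = sym (+-cancelʳ-≡ (n * (M C n)) _ _ (begin
  suc n * (M C suc n) + n * (M C n) ≡⟨ absorption M n ⟩
  M * (M C n)                       ≡⟨ split n (M C n) ⟩
  suc (suc n) * (M C n) + n * (M C n) ∎))
  where
  open ≡-Reasoning
  M = 2 * suc n
  split : ∀ n a → 2 * suc n * a ≡ suc (suc n) * a + n * a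
  split = solve-∀

catalan≗ballot : C[x] ≗ ballot 1
catalan≗ballot n = trans (cong (_/ suc n) C≡b*n) (m*n/n≡m (ballot 1 n) (suc n))
  where
  open ≡-Reasoning
  top : n + n + 0 ≡ 2 * n
  top = +-assoc n n 0
  diff : ballot 1 n + lowerC (2 * n) n ≡ (2 * n) C n
  diff = subst (λ m → ballot 1 n + lowerC m n ≡ m C n) top (ballot-binomial 0 n)
  -- Multiplying `diff` by n + 1 makes its second term n binom(2n,n), which cancels and leaves a
  -- single binomial. So the division in `catalan` is exact.
  C≡b*n : (2 * n) C n ≡ ballot 1 n * suc n
  C≡b*n = +-cancelʳ-≡ (n * ((2 * n) C n)) _ _ (begin
    suc n * ((2 * n) C n)                           ≡⟨ cong (suc n *_) diff ⟨
    suc n * (ballot 1 n + lowerC (2 * n) n)         ≡⟨ *-distribˡ-+ (suc n) (ballot 1 n) _ ⟩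
    suc n * ballot 1 n + suc n * lowerC (2 * n) n   ≡⟨ cong₂ _+_ (*-comm (suc n) (ballot 1 n)) ([1+n]*lowerC[2n,n] n) ⟩
    ballot 1 n * suc n + n * ((2 * n) C n)          ∎)

C[x]^≗ballot : ∀ k → C[x] ^ k ≗ ballot k
C[x]^≗ballot zero    n = sym (ballot-zero n)
C[x]^≗ballot (suc k) n = trans (·-cong catalan≗ballot (C[x]^≗ballot k) n) (ballot-· 1 k n)

-- Permutations

-- The size is an index, so that enumerations of disjoint cases combine into a recurrence for the
-- counts; by `enum-size` it depends on the predicate alone.
record Enumeration {A : Set} (P : A → Set) (c : ℕ) : Set where
  field
    list   : List A
    unique : List.Unique list
    sound  : ∀ {x} → x List.∈ list → P x
    full   : ∀ {x} → P x → x List.∈ list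
    size   : length list ≡ c

open Enumeration

module _ {A : Set} {P Q : A → Set} where

  enum-cong : ∀ {c} → (∀ {x} → P x → Q x) → (∀ {x} → Q x → P x) →
              Enumeration P c → Enumeration Q c
  enum-cong P⇒Q Q⇒P e = record
    { list = list e ; unique = unique e ; size = size e
    ; sound = P⇒Q ∘ sound e ; full = full e ∘ Q⇒P }

  enum-⊎ : ∀ {c d} → (∀ {x} → P x → ¬ Q x) →
           Enumeration P c → Enumeration Q d → Enumeration (λ x → P x ⊎ Q x) (c + d)
  enum-⊎ disjoint e f = record
    { list   = list e List.++ list f
    ; unique = List.++⁺ (unique e) (unique f)
                 λ (x∈e , x∈f) → disjoint (sound e x∈e) (sound f x∈f)
    ; sound  = λ x∈ → Sum.map (sound e) (sound f) (∈-++⁻ (list e) x∈)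
    ; full   = λ { (inj₁ p) → ∈-++⁺ˡ (full e p) ; (inj₂ q) → ∈-++⁺ʳ (list e) (full f q) }
    ; size   = trans (length-++ (list e)) (cong₂ _+_ (size e) (size f)) }

enum-image : ∀ {A B : Set} {P : A → Set} {c} (f : A → B) → (∀ {x y} → f x ≡ f y → x ≡ y) →
             Enumeration P c → Enumeration (λ y → ∃ λ x → P x × y ≡ f x) c
enum-image f f-injective e = record
  { list   = List.map f (list e)
  ; unique = List.map⁺ f-injective (unique e)
  ; sound  = λ y∈ → let x , x∈ , y≡ = ∈-map⁻ f y∈ in x , sound e x∈ , y≡
  ; full   = λ { (x , p , refl) → ∈-map⁺ f (full e p) }
  ; size   = trans (length-map f (list e)) (size e) }

-- Two duplicate-free lists with the same members are permutations of each other.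
enum-size : ∀ {A : Set} {P : A → Set} {c d} → Enumeration P c → Enumeration P d → c ≡ d
enum-size e f = trans (sym (size e)) (trans
  (↭-length (∼bag⇒↭ (unique∧set⇒bag (unique e) (unique f)
    (mk⇔ (full f ∘ sound e) (full e ∘ sound f)))))
  (size f))

counted-enum : ∀ {k} (p : Vec (Fin k) k) n → Enumeration (Counted {k} {n} p) (N²⁻³¹ p n)
counted-enum p n = record
  { list   = filter (counted? p) (words n n)
  ; unique = List.filter⁺ (counted? p) (words-unique n n)
  ; sound  = λ x∈ → proj₂ (∈-filter⁻ (counted? p) {xs = words n n} x∈)
  ; full   = λ {x} → ∈-filter⁺ (counted? p) (∈-words x)
  ; size   = refl }

-- Occurrences of 2-31 and initial descents in words

private variable
  m n k : ℕ
  a b c : Fin m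
  w : Vec (Fin m) n

-- The adjacent pair b c plays the 31 of an occurrence whose 2 is a letter a standing before the
-- word. Alphabet and length are independent, so that suffixes of permutations are covered.
data Straddled {m} (a : Fin m) : ∀ {n} → Vec (Fin m) n → Set where
  here  : c Fin.< a → a Fin.< b → Straddled a (b ∷ c ∷ w)
  there : Straddled a w → Straddled a (b ∷ w)

data Contains {m} : ∀ {n} → Vec (Fin m) n → Set where
  here  : Straddled a w → Contains (a ∷ w)
  there : Contains w → Contains (a ∷ w)

data Descends {m} : ℕ → ∀ {n} → Vec (Fin m) n → Set where
  []  : Descends 0 w
  [-] : Descends 1 (a ∷ w)
  _∷_ : b Fin.< a → Descends (suc k) (b ∷ w) → Descends (suc (suc k)) (a ∷ b ∷ w)

descends? : ∀ k (w : Vec (Fin m) n) → Dec (Descends k w)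
descends? zero          w           = yes []
descends? (suc k)       []          = no λ ()
descends? (suc zero)    (a ∷ w)     = yes [-]
descends? (suc (suc k)) (a ∷ [])    = no λ ()
descends? (suc (suc k)) (a ∷ b ∷ w) with b Fin.<? a | descends? (suc k) (b ∷ w)
... | yes b<a | yes d = yes (b<a ∷ d)
... | no  b≮a | _     = no λ { (b<a ∷ _) → b≮a b<a }
... | yes _   | no ¬d = no λ { (_ ∷ d) → ¬d d }

descends-tail : Descends (suc k) (a ∷ w) → Descends k w
descends-tail [-]     = []
descends-tail (_ ∷ d) = d

-- Lets an induction along the word keep the head a fixed while it passes over the letters of the
-- descent.
descends-drop : Descends (suc (suc k)) (a ∷ b ∷ w) → Descends (suc k) (a ∷ w)
descends-drop (b<a ∷ [-])       = [-]
descends-drop (b<a ∷ (c<b ∷ d)) = Fin.<-trans c<b b<a ∷ d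

descends-pred : Descends (suc k) w → Descends k w
descends-pred [-]                   = []
descends-pred (b<a ∷ [-])           = [-]
descends-pred (b<a ∷ d@(_ ∷ _))     = b<a ∷ descends-pred d

descends⇒≤ : {w : Vec (Fin m) n} → Descends k w → k ≤ n
descends⇒≤ []      = z≤n
descends⇒≤ [-]     = s≤s z≤n
descends⇒≤ (_ ∷ d) = s≤s (descends⇒≤ d)

-- Inserting a new minimum at the end of the descent

map-injective : ∀ {A B : Set} {f : A → B} → (∀ {x y} → f x ≡ f y → x ≡ y) →
                ∀ {n} {v w : Vec A n} → Vec.map f v ≡ Vec.map f w → v ≡ w
map-injective f-injective {v = []}    {[]}    eq = refl
map-injective f-injective {v = x ∷ v} {y ∷ w} eq with fx≡fy , fv≡fw ← ∷-injective eq =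
  cong₂ _∷_ (f-injective fx≡fy) (map-injective f-injective fv≡fw)

-- For k beyond the length of the word, the 0 goes to the end.
insert : ℕ → Vec (Fin m) n → Vec (Fin (suc m)) (suc n)
insert zero    w       = zero ∷ Vec.map suc w
insert (suc k) []      = zero ∷ []
insert (suc k) (a ∷ w) = suc a ∷ insert k w

insert-injective : ∀ k {v w : Vec (Fin m) n} → insert k v ≡ insert k w → v ≡ w
insert-injective zero    eq = map-injective Fin.suc-injective (proj₂ (∷-injective eq))
insert-injective (suc k) {[]}    {[]}    eq = refl
insert-injective (suc k) {a ∷ v} {b ∷ w} eq with a≡b , v≡w ← ∷-injective eq =
  cong₂ _∷_ (Fin.suc-injective a≡b) (insert-injective k v≡w)

module _ {P : Fin (suc m) → Set} where

  All-insert⁺ : ∀ k {w : Vec (Fin m) n} → P zero → All (P ∘ suc) w → All P (insert k w)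
  All-insert⁺ zero    p ps       = p ∷ All.map⁺ ps
  All-insert⁺ (suc k) p []       = p ∷ []
  All-insert⁺ (suc k) p (q ∷ ps) = q ∷ All-insert⁺ k p ps

  All-insert⁻ : ∀ k (w : Vec (Fin m) n) → All P (insert k w) → All (P ∘ suc) w
  All-insert⁻ zero    w       (_ ∷ ps) = All.map⁻ ps
  All-insert⁻ (suc k) []      _        = []
  All-insert⁻ (suc k) (a ∷ w) (q ∷ ps) = q ∷ All-insert⁻ k w ps

Unique-insert⁺ : ∀ k {w : Vec (Fin m) n} → Unique w → Unique (insert k w)
Unique-insert⁺ zero    {w} u        = All.map⁺ (All.universal (λ _ ()) w) ∷ Unique.map⁺ Fin.suc-injective u
Unique-insert⁺ (suc k) []       = [] ∷ []
Unique-insert⁺ (suc k) (a∉ ∷ u) =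
  All-insert⁺ k (λ ()) (All.map (λ a≢b → a≢b ∘ Fin.suc-injective) a∉) ∷ Unique-insert⁺ k u

Unique-map⁻ : (w : Vec (Fin m) n) → Unique (Vec.map Fin.suc w) → Unique w
Unique-map⁻ []      _        = []
Unique-map⁻ (a ∷ w) (a∉ ∷ u) = All.map (λ sa≢sb → sa≢sb ∘ cong suc) (All.map⁻ a∉) ∷ Unique-map⁻ w u

Unique-insert⁻ : ∀ k (w : Vec (Fin m) n) → Unique (insert k w) → Unique w
Unique-insert⁻ zero    w       (_ ∷ u)  = Unique-map⁻ w u
Unique-insert⁻ (suc k) []      _        = []
Unique-insert⁻ (suc k) (a ∷ w) (a∉ ∷ u) =
  All.map (λ sa≢sb → sa≢sb ∘ cong suc) (All-insert⁻ k w a∉) ∷ Unique-insert⁻ k w u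

Straddled-map⁺ : Straddled a w → Straddled (suc a) (Vec.map suc w)
Straddled-map⁺ (here c<a a<b) = here (s≤s c<a) (s≤s a<b)
Straddled-map⁺ (there s)      = there (Straddled-map⁺ s)

Straddled-map⁻ : (w : Vec (Fin m) n) → Straddled (suc a) (Vec.map suc w) → Straddled a w
Straddled-map⁻ (b ∷ c ∷ w) (here (s≤s c<a) (s≤s a<b)) = here c<a a<b
Straddled-map⁻ (b ∷ w)     (there s)                  = there (Straddled-map⁻ w s)

Contains-map⁺ : Contains w → Contains (Vec.map suc w)
Contains-map⁺ (here s)  = here (Straddled-map⁺ s)
Contains-map⁺ (there c) = there (Contains-map⁺ c)

Contains-map⁻ : (w : Vec (Fin m) n) → Contains (Vec.map suc w) → Contains w
Contains-map⁻ (a ∷ w) (here s)  = here (Straddled-map⁻ w s)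
Contains-map⁻ (a ∷ w) (there c) = there (Contains-map⁻ w c)

-- The new 0 can separate only the k-th and (k+1)-st letters of `w`. The first k letters lie below
-- a, so none of them can be the larger letter of a straddling pair, and every such pair survives.
Straddled-insert⁺ : ∀ k {w : Vec (Fin m) n} → Descends (suc k) (a ∷ w) →
                    Straddled a w → Straddled (suc a) (insert k w)
Straddled-insert⁺ zero    d s = there (Straddled-map⁺ s)
Straddled-insert⁺ (suc k) (b<a ∷ _) (here _ a<b) = contradiction a<b (Fin.<-asym b<a)
Straddled-insert⁺ (suc k) d         (there s)    = there (Straddled-insert⁺ k (descends-drop d) s)

straddled-tail : ¬ (a Fin.< b) → Straddled a (b ∷ w) → Straddled a w
straddled-tail a≮b (here _ a<b) = contradiction a<b a≮b
straddled-tail a≮b (there s)    = s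

-- The pairs created by the new 0 begin with a letter of the descent below a, or with 0 itself;
-- neither exceeds the 2 of the pattern.
Straddled-insert⁻ : ∀ k (w : Vec (Fin m) n) → Descends (suc k) (a ∷ w) →
                    Straddled (suc a) (insert k w) → Straddled a w
Straddled-insert⁻ zero    w       d s = Straddled-map⁻ w (straddled-tail (λ ()) s)
Straddled-insert⁻ (suc k) (b ∷ w) d@(b<a ∷ _) s = there
  (Straddled-insert⁻ k w (descends-drop d) (straddled-tail (λ { (s≤s a<b) → Fin.<-asym b<a a<b }) s))

¬Straddled-zero : (w : Vec (Fin (suc m)) n) → ¬ Straddled zero w
¬Straddled-zero (b ∷ w) (there s) = ¬Straddled-zero w s

Contains-insert⁺ : ∀ k {w : Vec (Fin m) n} → Descends k w → Contains w → Contains (insert k w)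
Contains-insert⁺ zero    d c         = there (Contains-map⁺ c)
Contains-insert⁺ (suc k) d (here s)  = here (Straddled-insert⁺ k d s)
Contains-insert⁺ (suc k) d (there c) = there (Contains-insert⁺ k (descends-tail d) c)

Contains-insert⁻ : ∀ k (w : Vec (Fin m) n) → Descends k w → Contains (insert k w) → Contains w
Contains-insert⁻ zero    w       d (here s)  = contradiction s (¬Straddled-zero _)
Contains-insert⁻ zero    w       d (there c) = Contains-map⁻ w c
Contains-insert⁻ (suc k) (a ∷ w) d (here s)  = here (Straddled-insert⁻ k w d s)
Contains-insert⁻ (suc k) (a ∷ w) d (there c) = there (Contains-insert⁻ k w (descends-tail d) c)

Descends-insert⁺ : {w : Vec (Fin m) n} → Descends k w → Descends (suc k) (insert k w)
Descends-insert⁺ []        = [-]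
Descends-insert⁺ [-]       = s≤s z≤n ∷ [-]
Descends-insert⁺ (b<a ∷ d) = s≤s b<a ∷ Descends-insert⁺ d

Descends-insert⁻ : ∀ k (w : Vec (Fin m) n) → Descends (suc k) (insert k w) → Descends k w
Descends-insert⁻ zero          w           d               = []
Descends-insert⁻ (suc zero)    (a ∷ w)     d               = [-]
Descends-insert⁻ (suc (suc k)) (a ∷ b ∷ w) (s≤s b<a ∷ d)   = b<a ∷ Descends-insert⁻ (suc k) (b ∷ w) d
Descends-insert⁻ (suc (suc k)) (a ∷ [])    (_ ∷ ())

¬Descends-insert : ∀ k (w : Vec (Fin m) n) → ¬ Descends (suc (suc k)) (insert k w)
¬Descends-insert zero    (a ∷ w) (() ∷ _)
¬Descends-insert (suc k) (a ∷ w) d = ¬Descends-insert k w (descends-tail d)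

zero∈⊎map-suc : (w : Vec (Fin (suc m)) n) → zero ∈ w ⊎ ∃ λ σ → w ≡ Vec.map suc σ
zero∈⊎map-suc []         = inj₂ ([] , refl)
zero∈⊎map-suc (zero ∷ w) = inj₁ (here refl)
zero∈⊎map-suc (suc a ∷ w) with zero∈⊎map-suc w
... | inj₁ 0∈w          = inj₁ (there 0∈w)
... | inj₂ (σ , refl) = inj₂ (a ∷ σ , refl)

-- Pigeonhole: without 0, the n + 1 distinct letters would lie among n values.
zero∈permutation : (π : Vec (Fin (suc n)) (suc n)) → Unique π → zero ∈ π
zero∈permutation π u with zero∈⊎map-suc π
... | inj₁ 0∈π        = 0∈π
... | inj₂ (σ , refl) = contradiction
  (Fin.injective⇒≤ λ {i} {j} → Unique.lookup-injective (Unique-map⁻ σ u) i j) ℕ.1+n≰n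

-- The first later letter below a would directly follow a letter above a, and these two would
-- straddle a.
above : a Fin.< b → ¬ Straddled a (b ∷ w) → All (a ≢_) w → All (a Fin.<_) (b ∷ w)
above                   a<b ¬s []          = a<b ∷ []
above {a = a} {w = c ∷ _} a<b ¬s (a≢c ∷ a∉) with Fin.<-cmp a c
... | tri< a<c _ _ = a<b ∷ above a<c (¬s ∘ there) a∉
... | tri≈ _ a≡c _ = contradiction a≡c a≢c
... | tri> _ _ c<a = contradiction (here c<a a<b) ¬s

insert-zero : {w : Vec (Fin (suc m)) n} → Unique (zero ∷ w) → ∃ λ σ → zero ∷ w ≡ insert 0 σ
insert-zero {w = w} (0∉w ∷ _) with zero∈⊎map-suc w
... | inj₁ 0∈w        = contradiction refl (All.lookup 0∉w 0∈w)
... | inj₂ (σ , refl) = σ , refl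

-- If the descent stops at a letter a, then all later letters exceed a, since
-- one below a would create an occurrence of 2-31 with a as its 2; hence a = 0.
uninsert : ∀ k {w : Vec (Fin (suc m)) (suc n)} → Unique w → ¬ Contains w → zero ∈ w →
           Descends (suc k) w → ¬ Descends (suc (suc k)) w → ∃ λ σ → w ≡ insert k σ
uninsert zero u ¬c (here refl) _ _ = insert-zero u
uninsert zero {a ∷ b ∷ w} ((a≢b ∷ a∉w) ∷ _) ¬c (there 0∈w) _ ¬d with Fin.<-cmp a b
... | tri< a<b _ _ with () ← All.lookup (above a<b (¬c ∘ here) a∉w) 0∈w
... | tri≈ _ a≡b _ = contradiction a≡b a≢b
... | tri> _ _ b<a = contradiction (b<a ∷ [-]) ¬d
-- The head exceeds b, so it cannot be 0, and the 0 lies further on.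
uninsert (suc k) {suc a ∷ b ∷ w} (_ ∷ u) ¬c (there 0∈w) (b<a ∷ d) ¬d
  with σ , eq ← uninsert k u (¬c ∘ there) 0∈w d (¬d ∘ (b<a ∷_)) =
  a ∷ σ , cong (suc a ∷_) eq

-- Recurrence for the number of avoiders

-- The recursive counterpart of `Counted (descending k)`. On permutations the two differ only at the
-- empty one with k = 1, which the convention counts and `Good` does not.
Good : ℕ → ∀ {m n} → Vec (Fin m) n → Set
Good k w = Unique w × ¬ Contains w × Descends k w

Good-insert⁺ : {w : Vec (Fin m) n} → Good k w → Good (suc k) (insert k w)
Good-insert⁺ {k = k} {w = w} (u , ¬c , d) =
  Unique-insert⁺ k u , ¬c ∘ Contains-insert⁻ k w d , Descends-insert⁺ d

Good-insert⁻ : {w : Vec (Fin m) n} → Good (suc k) (insert k w) → Good k w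
Good-insert⁻ {k = k} {w = w} (u , ¬c , d) =
  Unique-insert⁻ k w u , ¬c ∘ Contains-insert⁺ k d′ , d′
  where d′ = Descends-insert⁻ k w d

-- The split is on whether the descent reaches letter k + 2: `¬Descends-insert` makes the cases
-- disjoint and `uninsert` makes them exhaustive.
good-step : ∀ {c d} → Enumeration (Good k {n} {n}) c → Enumeration (Good (suc (suc k)) {suc n} {suc n}) d →
            Enumeration (Good (suc k) {suc n} {suc n}) (c + d)
good-step {k = k} {n = n} e f = enum-cong to from
  (enum-⊎ (λ { (σ , _ , refl) (_ , _ , d) → ¬Descends-insert k σ d })
    (enum-image (insert k) (insert-injective k) e) f)
  where
  Split : Vec (Fin (suc n)) (suc n) → Set
  Split π = (∃ λ σ → Good k σ × π ≡ insert k σ) ⊎ Good (suc (suc k)) π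
  to : ∀ {π} → Split π → Good (suc k) π
  to (inj₁ (σ , g , refl)) = Good-insert⁺ g
  to (inj₂ (u , ¬c , d))   = u , ¬c , descends-pred d
  from : ∀ {π} → Good (suc k) π → Split π
  from {π} g@(u , ¬c , d) with descends? (suc (suc k)) π
  ... | yes d′ = inj₂ (u , ¬c , d′)
  ... | no ¬d with σ , refl ← uninsert k u ¬c (zero∈permutation π u) d ¬d =
    inj₁ (σ , Good-insert⁻ g , refl)

enum-empty : {A : Set} {P : A → Set} → (∀ {x} → ¬ P x) → Enumeration P 0
enum-empty ¬P = record
  { list = [] ; unique = List.[] ; size = refl
  ; sound = λ () ; full = λ p → contradiction p ¬P }

good-short : n ℕ.< k → Enumeration (Good k {n} {n}) 0
good-short n<k = enum-empty λ (_ , _ , d) → ℕ.<⇒≱ n<k (descends⇒≤ d)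

-- Here m is the number of letters after the first k. In these coordinates `good-step` is the
-- recurrence of `ballot`, with index one larger than the length of the descent.
good-enum : ∀ m k {n} → n ≡ m + k → Enumeration (Good k {n} {n}) (ballot (suc k) m)
good-enum zero    zero    refl = record
  { list = [] ∷ [] ; unique = List.[] List.∷ List.[] ; size = refl
  ; sound = λ { (here refl) → [] , (λ ()) , [] } ; full = λ { {[]} _ → here refl } }
-- No word of length k + 1 begins with k + 2 descending letters, so the second summand is 0.
good-enum zero    (suc k) refl = good-step (good-enum zero k refl) (good-short ℕ.≤-refl)
-- A single letter always descends, so k = 0 and k = 1 select the same nonempty words;
-- correspondingly `ballot 1 (suc m)` reduces to `ballot 2 m`.
good-enum (suc m) zero    refl = enum-cong
  (λ (u , ¬c , d) → u , ¬c , []) (λ { {_ ∷ _} (u , ¬c , d) → u , ¬c , [-] })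
  (good-enum m 1 (sym (ℕ.+-suc m 0)))
good-enum (suc m) (suc k) refl = good-step
  (good-enum (suc m) k (ℕ.+-suc m k))
  (good-enum m (suc (suc k)) (sym (ℕ.+-suc m (suc k))))

-- Agreement with the definitions by order isomorphism

-- Halfway between `Contains` and `Contains2-31`: positions are explicit, but the order isomorphism
-- is reduced to the two inequalities that determine it.
Occurrence : Vec (Fin m) n → Set
Occurrence {n = n} w = Σ (Fin n) λ i → Σ (Fin n) λ j → Σ (Fin n) λ j⁺ →
  i Fin.< j × toℕ j⁺ ≡ suc (toℕ j) × lookup w j⁺ Fin.< lookup w i × lookup w i Fin.< lookup w j

straddled⇒descent : {w : Vec (Fin m) n} → Straddled a w → ∃₂ λ j j⁺ →
  toℕ j⁺ ≡ suc (toℕ j) × lookup w j⁺ Fin.< a × a Fin.< lookup w j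
straddled⇒descent (here c<a a<b) = zero , suc zero , refl , c<a , a<b
straddled⇒descent (there s) with j , j⁺ , eq , lts ← straddled⇒descent s =
  suc j , suc j⁺ , cong suc eq , lts

contains⇒occurrence : Contains w → Occurrence w
contains⇒occurrence (here s) with j , j⁺ , eq , c<a , a<b ← straddled⇒descent s =
  zero , suc j , suc j⁺ , s≤s z≤n , cong suc eq , c<a , a<b
contains⇒occurrence (there c) with i , j , j⁺ , i<j , eq , lts ← contains⇒occurrence c =
  suc i , suc j , suc j⁺ , s≤s i<j , cong suc eq , lts

descent⇒straddled : (w : Vec (Fin m) n) (j j⁺ : Fin n) → toℕ j⁺ ≡ suc (toℕ j) →
  lookup w j⁺ Fin.< a → a Fin.< lookup w j → Straddled a w
descent⇒straddled (b ∷ c ∷ w) zero    (suc zero) _  c<a a<b = here c<a a<b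
descent⇒straddled (b ∷ w)     (suc j) (suc j⁺)   eq c<a a<b =
  there (descent⇒straddled w j j⁺ (ℕ.suc-injective eq) c<a a<b)

occurrence⇒contains : (w : Vec (Fin m) n) → Occurrence w → Contains w
occurrence⇒contains (a ∷ w) (zero , suc j , suc j⁺ , _ , eq , c<a , a<b) =
  here (descent⇒straddled w j j⁺ (ℕ.suc-injective eq) c<a a<b)
occurrence⇒contains (a ∷ w) (suc i , suc j , suc j⁺ , s≤s i<j , eq , lts) =
  there (occurrence⇒contains w (i , j , j⁺ , i<j , ℕ.suc-injective eq , lts))

both : {A B : Set} → A → B → A ⇔ B
both x y = mk⇔ (const y) (const x)

neither : {A B : Set} → ¬ A → ¬ B → A ⇔ B
neither ¬x ¬y = mk⇔ (λ x → contradiction x ¬x) (λ y → contradiction y ¬y)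

231-isomorphic : c Fin.< a → a Fin.< b → OrderIsomorphic (a ∷ b ∷ c ∷ []) 231-pattern
231-isomorphic c<a a<b 0F 0F = neither (Fin.<-irrefl refl) λ { (s≤s ()) }
231-isomorphic c<a a<b 0F 1F = both a<b (s≤s (s≤s z≤n))
231-isomorphic c<a a<b 0F 2F = neither (Fin.<-asym c<a) λ ()
231-isomorphic c<a a<b 1F 0F = neither (Fin.<-asym a<b) λ { (s≤s ()) }
231-isomorphic c<a a<b 1F 1F = neither (Fin.<-irrefl refl) λ { (s≤s (s≤s ())) }
231-isomorphic c<a a<b 1F 2F = neither (Fin.<-asym (Fin.<-trans c<a a<b)) λ ()
231-isomorphic c<a a<b 2F 0F = both c<a (s≤s z≤n)
231-isomorphic c<a a<b 2F 1F = both (Fin.<-trans c<a a<b) (s≤s z≤n)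
231-isomorphic c<a a<b 2F 2F = neither (Fin.<-irrefl refl) λ ()

contains⇒Contains2-31 : {π : Vec (Fin n) n} → Contains π → Contains2-31 π
contains⇒Contains2-31 c with i , j , j⁺ , i<j , eq , c<a , a<b ← contains⇒occurrence c =
  i , j , j⁺ , i<j , eq , 231-isomorphic c<a a<b

Contains2-31⇒contains : {π : Vec (Fin n) n} → Contains2-31 π → Contains π
Contains2-31⇒contains {π = π} (i , j , j⁺ , i<j , eq , iso) = occurrence⇒contains π
  (i , j , j⁺ , i<j , eq
  , Equivalence.from (iso 2F 0F) (s≤s z≤n) , Equivalence.from (iso 0F 1F) (s≤s (s≤s z≤n)))

Antitone : Vec (Fin m) n → Set
Antitone w = ∀ i j → i Fin.< j → lookup w j Fin.< lookup w i

descends⇒<head : (k≤n : k ≤ n) {w : Vec (Fin m) n} → Descends (suc k) (a ∷ w) →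
  ∀ j → lookup (truncate k≤n w) j Fin.< a
descends⇒<head (s≤s k≤n) {b ∷ w} (b<a ∷ _) zero    = b<a
descends⇒<head (s≤s k≤n) {b ∷ w} d         (suc j) = descends⇒<head k≤n (descends-drop d) j

descends⇒antitone : (k≤n : k ≤ n) {w : Vec (Fin m) n} → Descends k w → Antitone (truncate k≤n w)
descends⇒antitone k≤n       {a ∷ w} d (suc i) zero    ()
descends⇒antitone (s≤s k≤n) {a ∷ w} d zero    (suc j) _ = descends⇒<head k≤n d j
descends⇒antitone (s≤s k≤n) {a ∷ w} d (suc i) (suc j) (s≤s i<j) =
  descends⇒antitone k≤n (descends-tail d) i j i<j

antitone⇒descends : (k≤n : k ≤ n) (w : Vec (Fin m) n) → Antitone (truncate k≤n w) → Descends k w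
antitone⇒descends z≤n             w           _    = []
antitone⇒descends (s≤s z≤n)       (a ∷ w)     _    = [-]
antitone⇒descends (s≤s (s≤s k≤n)) (a ∷ b ∷ w) anti = anti 0F 1F (s≤s z≤n)
  ∷ antitone⇒descends (s≤s k≤n) (b ∷ w) (λ i j i<j → anti (suc i) (suc j) (s≤s i<j))

opposite-anti : {i j : Fin n} → i Fin.< j → opposite j Fin.< opposite i
opposite-anti {n = n} {i} {j} i<j = subst₂ ℕ._<_ (sym (Fin.opposite-prop j)) (sym (Fin.opposite-prop i))
  (ℕ.∸-monoʳ-< (s≤s i<j) (Fin.toℕ<n j))

descending-antitone : ∀ k → Antitone (descending k)
descending-antitone k i j i<j
  rewrite lookup∘tabulate opposite i | lookup∘tabulate opposite j = opposite-anti i<j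

antitone-< : (v : Vec (Fin m) k) → Antitone v → ∀ i j → lookup v i Fin.< lookup v j → j Fin.< i
antitone-< v anti i j vi<vj with Fin.<-cmp i j
... | tri< i<j _ _  = contradiction vi<vj (Fin.<-asym (anti i j i<j))
... | tri≈ _ refl _ = contradiction vi<vj (Fin.<-irrefl refl)
... | tri> _ _ j<i  = j<i

-- In a strictly decreasing word the order of two entries is the reverse of the order of their
-- positions, hence the same for both words.
antitone⇒isomorphic : (v : Vec (Fin m) k) (w : Vec (Fin n) k) →
                      Antitone v → Antitone w → OrderIsomorphic v w
antitone⇒isomorphic v w v-anti w-anti i j = mk⇔
  (w-anti j i ∘ antitone-< v v-anti i j) (v-anti j i ∘ antitone-< w w-anti i j)

isomorphic⇒antitone : (v : Vec (Fin m) k) (w : Vec (Fin n) k) →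
                      Antitone w → OrderIsomorphic v w → Antitone v
isomorphic⇒antitone v w w-anti iso i j i<j = Equivalence.from (iso j i) (w-anti i j i<j)

good⇒counted : {π : Vec (Fin n) n} → Good k π → Counted (descending k) π
good⇒counted {k = k} {π} (u , ¬c , d) = u , ¬c ∘ Contains2-31⇒contains , inj₁ (descends⇒≤ d ,
  antitone⇒isomorphic (truncate (descends⇒≤ d) π) (descending k)
    (descends⇒antitone (descends⇒≤ d) d) (descending-antitone k))

counted⇒good : {π : Vec (Fin n) n} → ¬ (n ≡ 0 × k ≡ 1) → Counted (descending k) π → Good k π
counted⇒good {k = k} {π} _ (u , av , inj₁ (k≤n , iso)) = u , av ∘ contains⇒Contains2-31 ,
  antitone⇒descends k≤n π
    (isomorphic⇒antitone (truncate k≤n π) (descending k) (descending-antitone k) iso)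
counted⇒good ¬exceptional (_ , _ , inj₂ exceptional) = contradiction exceptional ¬exceptional

N-descending : ∀ k n {c} → ¬ (n ≡ 0 × k ≡ 1) → Enumeration (Good k {n} {n}) c →
               N²⁻³¹ (descending k) n ≡ c
N-descending k n ¬exceptional e = enum-size (counted-enum (descending k) n)
  (enum-cong good⇒counted (counted⇒good ¬exceptional) e)

proposition8 : (k : ℕ) → 1 ≤ k →
    (2 ≤ k → G²⁻³¹ (descending k) ≗ X ^ k · C[x] ^ (k + 1)) ×
    (k ≡ 1 → G²⁻³¹ (descending k) ≗ C[x])
proposition8 k _ = k≥2 , λ { refl → k≡1 }
  where
  k≥2 : 2 ≤ k → G²⁻³¹ (descending k) ≗ X ^ k · C[x] ^ (k + 1)
  k≥2 2≤k n with n ℕ.<? k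
  ... | yes n<k = trans
    (N-descending k n (λ { (_ , refl) → ℕ.1+n≰n 2≤k }) (good-short n<k))
    (sym (X^-·-< k (C[x] ^ (k + 1)) n<k))
  ... | no n≮k = begin
    N²⁻³¹ (descending k) n                    ≡⟨ N-descending k n (λ { (_ , refl) → ℕ.1+n≰n 2≤k })
                                                  (good-enum (n ∸ k) k (sym n∸k+k≡n)) ⟩
    ballot (suc k) (n ∸ k)                    ≡⟨ cong (λ j → ballot j (n ∸ k)) (ℕ.+-comm k 1) ⟨
    ballot (k + 1) (n ∸ k)                    ≡⟨ C[x]^≗ballot (k + 1) (n ∸ k) ⟨
    (C[x] ^ (k + 1)) (n ∸ k)                  ≡⟨ X^-·-+ k (C[x] ^ (k + 1)) (n ∸ k) ⟨
    (X ^ k · C[x] ^ (k + 1)) (n ∸ k + k)      ≡⟨ cong (X ^ k · C[x] ^ (k + 1)) n∸k+k≡n ⟩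
    (X ^ k · C[x] ^ (k + 1)) n                ∎
    where
    open ≡-Reasoning
    n∸k+k≡n = ℕ.m∸n+n≡m (ℕ.≮⇒≥ n≮k)
  k≡1 : G²⁻³¹ (descending 1) ≗ C[x]
  -- The convention on the empty permutation supplies the constant term 1, and both sides evaluate
  -- to it.
  k≡1 zero    = refl
  -- The enumeration has size `ballot 2 n`, to which `ballot 1 (suc n)` reduces.
  k≡1 (suc n) = trans
    (N-descending 1 (suc n) (λ ()) (good-enum n 1 (ℕ.+-comm 1 n)))
    (sym (catalan≗ballot (suc n)))
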